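{- Let $n\ge1$ and $\pi\in L_{n+1}$. Then there exist unique elements $\pi_j\in R_j^L$, $0\le j\le n-1$, such that $\pi=\pi_0\pi_1\cdots\pi_{n-1}$.
   Context: $B_m$ is the group of bijections $\sigma$ of $\{\pm1,\dots,\pm m\}$ with $\sigma(-i)=-\sigma(i)$, written in window notation $[\sigma(1),\dots,\sigma(m)]$, with product $(\sigma\tau)(i)=\sigma(\tau(i))$. Let $s_0=[-1,2,\dots,m]$ and $s_i=$ the transposition of $i$ and $i+1$. For $\sigma\in B_m$ let $|\sigma|$ be the permutation $i\mapsto|\sigma(i)|$, and $L_m=\{\sigma\in B_m:|\sigma|\text{ is even}\}$. In $L_{n+1}$ let $a_0=s_0$ and $a_i=s_1s_{i+1}$ for $1\le i\le n-1$. Let $R_0^L=\{1,\ a_0,\ a_1a_0a_1^{ -1},\ a_0a_1a_0a_1^{ -1}\}$ (here, when $n=1$, $a_1$ denotes $s_1s_2$ computed in a larger group is not needed: for $n=1$ one has $R_0^L=L_2$ as an explicit set, namely $\{[1,2],[-1,2],[1,-2],[-1,-2]\}$). For $1\le j\le n-1$ let $R_j^A=\{1,\ a_j,\ a_ja_{j-1},\ \dots,\ a_j\cdots a_2,\ a_j\cdots a_2a_1,\ a_j\cdots a_2a_1^{ -1}\}$ and $R_j^L=R_j^A\cup\{a_j\cdots a_2a_1^{ -1}a_0,\ a_j\cdots a_2a_1^{ -1}a_0a_1^{ -1}\}\cup\{a_j\cdots a_2a_1^{ -1}a_0a_1a_2\cdots a_k:\ 1\le k\le j\}$, where $a_j\cdots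 a_2$ is the empty product when $j=1$. -}

module Defs where

open import Algebra.Bundles using (Group)
open import Data.Fin.Base using (Fin; zero; suc; toℕ; inject₁)
open import Data.Fin.Patterns using (0F; 1F)
import Data.Fin.Properties as Fin
open import Data.Fin.Permutation using (Permutation′; transpose; permutation; _⟨$⟩ʳ_)
open import Data.List.Base using (List; []; _∷_; map; foldr; filter; length; reverse; allFin; cartesianProduct)
open import Data.List.Membership.Propositional using () renaming (_∈_ to _∈ₗ_)
import Data.List.Membership.Setoid as SetoidMembership
open import Data.Nat.Base using (ℕ; zero; suc; _≤_)
open import Data.Nat.Divisibility using (_∣_)
open import Data.Product.Base using (_×_; _,_; proj₂; ∃-syntax; map₁; map₂)
open import Data.Sign.Base using (Sign; +; -; opposite)
open import Data.Sign.Properties using (opposite-involutive)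
open import Data.Vec.Base as Vec using (Vec)
import Data.Vec.Functional as Vector
open import Function.Bundles using (_↔_; Inverse; mk↔ₛ′)
open import Function.Construct.Composition using (_↔-∘_)
open import Function.Construct.Identity using (↔-id)
open import Function.Construct.Symmetry using (↔-sym)
open import Level using (0ℓ)
open import Relation.Binary.PropositionalEquality
  using (_≡_; refl; sym; trans; cong; module ≡-Reasoning)
open import Relation.Nullary.Decidable using (_×-dec_)
open import Relation.Unary using (Pred; _∪_)

-- {±1,…,±m}: the pair (ε , i) stands for the integer ε(toℕ i + 1).
± : ℕ → Set
± m = Sign × Fin m

neg : ∀ {m} → ± m → ± m
neg = map₁ opposite

record B (m : ℕ) : Set where
  field
    bijection : ± m ↔ ± m
  open Inverse bijection public using (to; from)
  field
    to-neg : ∀ x → to (neg x) ≡ neg (to x)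

  to-from : ∀ x → to (from x) ≡ x
  to-from x = Inverse.strictlyInverseˡ bijection x

  from-to : ∀ x → from (to x) ≡ x
  from-to x = Inverse.strictlyInverseʳ bijection x

  from-neg : ∀ x → from (neg x) ≡ neg (from x)
  from-neg x = begin
    from (neg x)              ≡⟨ cong (λ y → from (neg y)) (to-from x) ⟨
    from (neg (to (from x)))  ≡⟨ cong from (to-neg (from x)) ⟨
    from (to (neg (from x)))  ≡⟨ from-to (neg (from x)) ⟩
    neg (from x)              ∎
    where open ≡-Reasoning

open B public

private variable m n : ℕ

-- Elements of B_m are equal when they are equal as maps; the proof fields play
-- no role.
infix 4 _≈_
_≈_ : B m → B m → Set
σ ≈ τ = ∀ x → to σ x ≡ to τ x

infixl 7 _·_
_·_ : B m → B m → B m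
σ · τ = record
  { bijection = bijection σ ↔-∘ bijection τ
  ; to-neg    = λ x → trans (cong (to σ) (to-neg τ x)) (to-neg σ (to τ x))
  }

𝟙 : B m
𝟙 = record { bijection = ↔-id _ ; to-neg = λ _ → refl }

infix 8 _⁻¹
_⁻¹ : B m → B m
σ ⁻¹ = record { bijection = ↔-sym (bijection σ) ; to-neg = from-neg σ }

B-group : ℕ → Group 0ℓ 0ℓ
B-group m = record
  { Carrier = B m
  ; _≈_     = _≈_
  ; _∙_     = _·_
  ; ε       = 𝟙
  ; _⁻¹     = _⁻¹
  ; isGroup = record
    { isMonoid = record
      { isSemigroup = record
        { isMagma = record
          { isEquivalence = record
            { refl  = λ _ → refl
            ; sym   = λ p x → sym (p x)
            ; trans = λ p q x → trans (p x) (q x)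
            }
          ; ∙-cong = λ {_} {σ′} {τ} p q x → trans (p (to τ x)) (cong (to σ′) (q x))
          }
        ; assoc = λ _ _ _ _ → refl
        }
      ; identity = (λ _ _ → refl) , (λ _ _ → refl)
      }
    ; inverse = (λ σ → from-to σ) , (λ σ → to-from σ)
    ; ⁻¹-cong = λ {σ} {τ} p x → begin
        from σ x                      ≡⟨ cong (from σ) (to-from τ x) ⟨
        from σ (to τ (from τ x))      ≡⟨ cong (from σ) (p (from τ x)) ⟨
        from σ (to σ (from τ x))      ≡⟨ from-to σ (from τ x) ⟩
        from τ x                      ∎
    }
  }
  where open ≡-Reasoning

window : B m → Vec (± m) m
window σ = Vec.tabulate λ i → to σ (+ , i)

-- The set of elements of a list, up to _≈_.
⟨_⟩ : List (B m) → Pred (B m) 0ℓ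
⟨_⟩ {m} σs σ = σ ∈ₛ σs
  where open SetoidMembership (Group.setoid (B-group m)) using () renaming (_∈_ to _∈ₛ_)

abs-cancel : (σ τ : B m) → (∀ x → to σ (to τ x) ≡ x) →
             ∀ i → proj₂ (to σ (+ , proj₂ (to τ (+ , i)))) ≡ i
abs-cancel σ τ στ≡id i with to τ (+ , i) | στ≡id (+ , i)
... | + , k | eq = cong proj₂ eq
... | - , k | eq = trans (cong proj₂ (sym (to-neg σ (+ , k)))) (cong proj₂ eq)

∣_∣ : B m → Permutation′ m
∣ σ ∣ = permutation (λ i → proj₂ (to σ (+ , i))) (λ i → proj₂ (to (σ ⁻¹) (+ , i)))
          (abs-cancel σ (σ ⁻¹) (to-from σ)) (abs-cancel (σ ⁻¹) σ (from-to σ))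

inversions : Permutation′ m → List (Fin m × Fin m)
inversions {m} ρ =
  filter (λ (i , j) → (i Fin.<? j) ×-dec ((ρ ⟨$⟩ʳ j) Fin.<? (ρ ⟨$⟩ʳ i)))
         (cartesianProduct (allFin m) (allFin m))

Even : Permutation′ m → Set
Even ρ = 2 ∣ length (inversions ρ)

L : ∀ m → Pred (B m) 0ℓ
L m σ = Even ∣ σ ∣

unsigned : Permutation′ m → B m
unsigned ρ = record
  { bijection = mk↔ₛ′ (map₂ (Inverse.to ρ)) (map₂ (Inverse.from ρ))
      (λ (ε , i) → cong (ε ,_) (Inverse.strictlyInverseˡ ρ i))
      (λ (ε , i) → cong (ε ,_) (Inverse.strictlyInverseʳ ρ i))
  ; to-neg = λ _ → refl
  }

negateFirst : ± (suc m) → ± (suc m)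
negateFirst (ε , zero)  = opposite ε , zero
negateFirst (ε , suc i) = ε , suc i

negateFirst-involutive : (x : ± (suc m)) → negateFirst (negateFirst x) ≡ x
negateFirst-involutive (ε , zero)  = cong (_, zero) (opposite-involutive ε)
negateFirst-involutive (ε , suc i) = refl

-- Index j : Fin m is s_j itself, with no shift: the integers i + 1 and i + 2
-- exchanged by s_{i+1} are encoded in Fin m as inject₁ i and suc i.
s : Fin m → B m
s {suc m} zero    = record
  { bijection = mk↔ₛ′ negateFirst negateFirst negateFirst-involutive negateFirst-involutive
  ; to-neg    = λ { (ε , zero) → refl ; (ε , suc i) → refl }
  }
s {suc m} (suc i) = unsigned (transpose (inject₁ i) (suc i))

-- Index j : Fin n is a_j itself, with no shift; the second clause is
-- a_{i+1} = s₁ s_{i+2}.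
a : Fin n → B (suc n)
a         zero    = s zero
a {suc n} (suc i) = s 1F · s (suc (suc i))

∏ : List (B m) → B m
∏ = foldr _·_ 𝟙

-- The list k, k+1, …, j of indices, empty when k > j.  The lower end is a
-- natural number since it may exceed every element of Fin n.
[_⋯_] : ℕ → Fin n → List (Fin n)
[ zero  ⋯ zero  ] = zero ∷ []
[ zero  ⋯ suc j ] = zero ∷ map suc [ zero ⋯ j ]
[ suc k ⋯ zero  ] = []
[ suc k ⋯ suc j ] = map suc [ k ⋯ j ]

-- a_k a_{k+1} ⋯ a_j
a↑ : ℕ → Fin n → B (suc n)
a↑ k j = ∏ (map a [ k ⋯ j ])

-- a_j a_{j-1} ⋯ a_k
a↓ : Fin n → ℕ → B (suc n)
a↓ j k = ∏ (map a (reverse [ k ⋯ j ]))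

a₀ : B (suc (suc n))
a₀ = a 0F

a₁ : B (suc (suc (suc n)))
a₁ = a 1F

-- The set R₀ inside L_{n+2}. For n = 0 there is no a₁ in that group, and the set
-- is given by the windows of its elements.
R₀ᴸ : ∀ n → Pred (B (suc (suc n))) 0ℓ
R₀ᴸ zero    σ = window σ ∈ₗ
    ((+ , 0F) Vec.∷ (+ , 1F) Vec.∷ Vec.[])
  ∷ ((- , 0F) Vec.∷ (+ , 1F) Vec.∷ Vec.[])
  ∷ ((+ , 0F) Vec.∷ (- , 1F) Vec.∷ Vec.[])
  ∷ ((- , 0F) Vec.∷ (- , 1F) Vec.∷ Vec.[])
  ∷ []
R₀ᴸ (suc n) = ⟨ 𝟙 ∷ a₀ ∷ a₁ · a₀ · a₁ ⁻¹ ∷ a₀ · a₁ · a₀ · a₁ ⁻¹ ∷ [] ⟩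

-- Only meant for j ≥ 1, so there are at least two generators and a₁ exists.
Rᴬ : Fin (suc (suc n)) → Pred (B (suc (suc (suc n)))) 0ℓ
Rᴬ j = ⟨ 𝟙 ∷ [] ⟩
     ∪ (λ σ → ∃[ k ] 1 ≤ k × k ≤ toℕ j × σ ≈ a↓ j k)
     ∪ ⟨ a↓ j 2 · a₁ ⁻¹ ∷ [] ⟩

Rᴸ : Fin n → Pred (B (suc n)) 0ℓ
Rᴸ {suc n}       zero      = R₀ᴸ n
Rᴸ {suc (suc n)} j@(suc _) =
    Rᴬ j
  ∪ ⟨ a↓ j 2 · a₁ ⁻¹ · a₀ ∷ a↓ j 2 · a₁ ⁻¹ · a₀ · a₁ ⁻¹ ∷ [] ⟩
  ∪ (λ σ → ∃[ k ] 1 ≤ toℕ k × toℕ k ≤ toℕ j × σ ≈ a↓ j 2 · a₁ ⁻¹ · a₀ · a↑ 1 k)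

∏ᵥ : (Fin n → B m) → B m
∏ᵥ = Vector.foldr _·_ 𝟙

{-# OPTIONS --safe #-}
module Submission where

-- The group L_{j+1} is the stabiliser of j+2 in L_{j+2}, so the right coset of π in
-- L_{j+2} is determined by π⁻¹(j+2).  Following j+2 through the inverses of the
-- generators shows that r ↦ r⁻¹(j+2) is a bijection from R_j onto {±1, …, ±(j+2)};
-- hence R_j is a transversal, and the last factor of π can be split off uniquely.
-- What remains at the end lies in L_2, which is R_0.  The generators lie in L because
-- a simple transposition changes the number of inversions by one, and a_i with i ≥ 1 is
-- a product of two of them.

open import Defs
open import Algebra.Bundles using (Group)
open import Data.Bool.Base using (Bool; true; false; if_then_else_)
open import Data.Fin.Base using (Fin; zero; suc; toℕ; inject₁; fromℕ; fromℕ<)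
open import Data.Fin.Patterns using (0F; 1F; 2F)
open import Data.Fin.Permutation
  using (Permutation′; transpose; _⟨$⟩ʳ_; _⟨$⟩ˡ_; inverseˡ; lift₀; lift₀-transpose)
import Data.Fin.Properties as Fin
open import Data.Fin.Relation.Unary.Top
  using (View; view; ‵fromℕ; ‵inject₁; view-fromℕ; view-inject₁)
open import Data.List.Base
  using (List; []; _∷_; map; foldr; foldl; reverse; filter; length;
         tabulate; allFin; cartesianProduct; _++_)
open import Data.List.Properties
  using (filter-++; filter-none; length-++; map-tabulate; foldr-map; foldl-map; reverse-foldl)
open import Data.List.Relation.Unary.All as All using (All; []; _∷_)
import Data.List.Relation.Unary.All.Properties as All
open import Data.List.Relation.Unary.Any using (here; there)
import Data.List.Relation.Unary.Any.Properties as Any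
open import Data.Nat.Base using (ℕ; zero; suc; _+_; _*_; _≤_; _<_; z≤n; s≤s; parity)
open import Data.Nat.Divisibility using (divides)
import Data.Nat.Properties as ℕ
open import Algebra.Properties.CommutativeMonoid.Sum ℕ.+-0-commutativeMonoid
  using (sum; sum-cong-≗; sum-permute)
open import Algebra.Properties.CommutativeSemigroup ℕ.+-commutativeSemigroup using (x∙yz≈y∙xz)
open import Data.Parity.Base as ℙ using (Parity; 0ℙ; 1ℙ)
import Data.Parity.Properties as Parity
open import Data.Product using (_×_; _,_; proj₂; ∃-syntax; ∃!)
open import Data.Sign.Base using () renaming (+ to ⁺; - to ⁻)
open import Data.Sum.Base as Sum using (_⊎_; inj₁; inj₂)
import Data.Vec.Base as Vec
open import Function.Base using (_∘_; id)
open import Function.Definitions using (Injective)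
open import Level using (0ℓ)
open import Relation.Binary.Definitions using (tri<; tri≈; tri>)
open import Relation.Binary.PropositionalEquality
  using (_≡_; _≢_; _≗_; refl; sym; trans; cong; cong₂; subst; module ≡-Reasoning)
open import Relation.Nullary.Decidable using (does; yes; no; _×-dec_; dec-true; dec-false)
open import Relation.Nullary.Negation using (contradiction)
open import Relation.Unary using (Pred; Decidable; _∈_)

private variable m n N ℓ ℓ′ : ℕ

-- Inversions and signs

indicator : Bool → ℕ
indicator b = if b then 1 else 0

length-filter-tabulate : ∀ {A : Set} {P : Pred A 0ℓ} (P? : Decidable P) (f : Fin n → A) →
  length (filter P? (tabulate f)) ≡ sum (λ i → indicator (does (P? (f i))))
length-filter-tabulate {n = zero}  P? f = refl
length-filter-tabulate {n = suc n} P? f with does (P? (f zero))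
... | true  = cong suc (length-filter-tabulate P? (f ∘ suc))
... | false = length-filter-tabulate P? (f ∘ suc)

length-filter-cartesianProduct : ∀ {A : Set} {P : Pred (A × A) 0ℓ} (P? : Decidable P)
  (f : Fin m → A) (g : Fin n → A) →
  length (filter P? (cartesianProduct (tabulate f) (tabulate g))) ≡
  sum (λ i → sum (λ j → indicator (does (P? (f i , g j)))))
length-filter-cartesianProduct {m = zero}  P? f g = refl
length-filter-cartesianProduct {m = suc m} P? f g = begin
  length (filter P? (row ++ rest))
    ≡⟨ cong length (filter-++ P? row rest) ⟩
  length (filter P? row ++ filter P? rest)
    ≡⟨ length-++ (filter P? row) ⟩
  length (filter P? row) + length (filter P? rest)
    ≡⟨ cong₂ _+_
         (trans (cong (length ∘ filter P?) (map-tabulate g (f zero ,_)))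
                (length-filter-tabulate P? (λ j → f zero , g j)))
         (length-filter-cartesianProduct P? (f ∘ suc) g) ⟩
  _ ∎
  where
  open ≡-Reasoning
  row  = map (f zero ,_) (tabulate g)
  rest = cartesianProduct (tabulate (f ∘ suc)) (tabulate g)

-- Written as a double sum so that `sum-permute` applies. Domain and codomain may differ in size,
-- which covers tails `f ∘ suc`.
inv : (Fin m → Fin N) → ℕ
inv f = sum (λ i → sum (λ j →
  indicator (does ((i Fin.<? j) ×-dec (f j Fin.<? f i)))))

length-inversions : (ρ : Permutation′ m) → length (inversions ρ) ≡ inv (ρ ⟨$⟩ʳ_)
length-inversions ρ = length-filter-cartesianProduct
  (λ (i , j) → (i Fin.<? j) ×-dec ((ρ ⟨$⟩ʳ j) Fin.<? (ρ ⟨$⟩ʳ i))) (λ i → i) (λ i → i)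

inv-cong : {f g : Fin m → Fin N} → f ≗ g → inv f ≡ inv g
inv-cong f≗g = sum-cong-≗ λ i → sum-cong-≗ λ j →
  cong₂ (λ x y → indicator (does ((i Fin.<? j) ×-dec (y Fin.<? x)))) (f≗g i) (f≗g j)

-- For `f` on `Fin (suc m)`, `inv f` unfolds by computation to
-- `below (f zero) (f ∘ suc) + inv (f ∘ suc)`.
below : Fin N → (Fin m → Fin N) → ℕ
below x f = sum (λ j → indicator (does (f j Fin.<? x)))

-- For `k = 0`, only the comparison of the first two values is reversed, while their counts against
-- the rest change places. For larger `k`, the values after the first are permuted, so the count
-- below the first is unchanged and induction handles the tail.
inv-transpose : (f : Fin (suc m) → Fin N) → Injective _≡_ _≡_ f → (k : Fin m) →
  let f′ = f ∘ (transpose (inject₁ k) (suc k) ⟨$⟩ʳ_) in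
  inv f′ ≡ suc (inv f) ⊎ inv f ≡ suc (inv f′)
inv-transpose {m = suc m} f f-inj zero = case₀
  where
  h = λ i → f (suc (suc i))
  case₀ : inv (f ∘ (transpose zero (suc zero) ⟨$⟩ʳ_)) ≡ suc (inv f) ⊎
          inv f ≡ suc (inv (f ∘ (transpose zero (suc zero) ⟨$⟩ʳ_)))
  case₀ with Fin.<-cmp (f zero) (f (suc zero))
  ... | tri≈ _ f₀≡f₁ _ with () ← f-inj f₀≡f₁
  ... | tri< f₀<f₁ _ f₁≮f₀
    rewrite dec-true (f zero Fin.<? f (suc zero)) f₀<f₁
          | dec-false (f (suc zero) Fin.<? f zero) f₁≮f₀
    = inj₁ (cong suc (x∙yz≈y∙xz (below (f (suc zero)) h) (below (f zero) h) (inv h)))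
  ... | tri> f₀≮f₁ _ f₁<f₀
    rewrite dec-false (f zero Fin.<? f (suc zero)) f₀≮f₁
          | dec-true (f (suc zero) Fin.<? f zero) f₁<f₀
    = inj₂ (cong suc (x∙yz≈y∙xz (below (f zero) h) (below (f (suc zero)) h) (inv h)))
inv-transpose {m = suc m} f f-inj (suc k) =
  Sum.map (λ eq → trans inv-f′ (trans (cong (below₀ +_) eq) (ℕ.+-suc below₀ _)))
          (λ eq → trans (cong (below₀ +_) eq) (trans (ℕ.+-suc below₀ _) (cong suc (sym inv-f′))))
          (inv-transpose g (Fin.suc-injective ∘ f-inj) k)
  where
  g = f ∘ suc
  t = transpose (inject₁ k) (suc k)
  below₀ = below (f zero) g

  f∘t≗ : f ∘ (transpose (inject₁ (suc k)) (suc (suc k)) ⟨$⟩ʳ_) ≗ f ∘ (lift₀ t ⟨$⟩ʳ_)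
  f∘t≗ = cong f ∘ lift₀-transpose (inject₁ k) (suc k)

  inv-f′ : inv (f ∘ (transpose (inject₁ (suc k)) (suc (suc k)) ⟨$⟩ʳ_)) ≡
           below₀ + inv (g ∘ (t ⟨$⟩ʳ_))
  inv-f′ = trans (inv-cong f∘t≗)
    (cong (_+ inv (g ∘ (t ⟨$⟩ʳ_)))
      (sym (sum-permute (λ j → indicator (does (g j Fin.<? f zero))) t)))

sign : B m → Parity
sign σ = parity (length (inversions ∣ σ ∣))

sign-L : {σ : B m} → σ ∈ L m → sign σ ≡ 0ℙ
sign-L {σ = σ} (divides q eq) = begin
  parity (length (inversions ∣ σ ∣))  ≡⟨ cong parity eq ⟩
  parity (q * 2)                      ≡⟨ Parity.*-homo-* q 2 ⟩
  parity q ℙ.* 0ℙ                     ≡⟨ Parity.*-zeroʳ (parity q) ⟩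
  0ℙ                                  ∎
  where open ≡-Reasoning

sign-inv : (σ : B m) → sign σ ≡ parity (inv (∣ σ ∣ ⟨$⟩ʳ_))
sign-inv σ = cong parity (length-inversions ∣ σ ∣)

sign-cong-abs : (σ τ : B m) → (∀ i → ∣ σ ∣ ⟨$⟩ʳ i ≡ ∣ τ ∣ ⟨$⟩ʳ i) → sign σ ≡ sign τ
sign-cong-abs σ τ eq = trans (sign-inv σ) (trans (cong parity (inv-cong eq)) (sym (sign-inv τ)))

sign-cong : (σ τ : B m) → σ ≈ τ → sign σ ≡ sign τ
sign-cong σ τ σ≈τ = sign-cong-abs σ τ (λ i → cong proj₂ (σ≈τ (⁺ , i)))

sign-𝟙 : sign (𝟙 {m}) ≡ 0ℙ
sign-𝟙 {m} = cong (parity ∘ length)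
  (filter-none (λ (i , j) → (i Fin.<? j) ×-dec (j Fin.<? i))
    {cartesianProduct (allFin m) (allFin m)}
    (All.universal (λ _ (i<j , j<i) → ℕ.<-asym i<j j<i) _))

sign-·-s₀ : (σ : B (suc m)) → sign (σ · s zero) ≡ sign σ
sign-·-s₀ σ = sign-cong-abs (σ · s zero) σ
  λ { zero → cong proj₂ (to-neg σ (⁺ , zero)) ; (suc i) → refl }

∣∣-injective : (σ : B m) → Injective _≡_ _≡_ (∣ σ ∣ ⟨$⟩ʳ_)
∣∣-injective σ eq = trans (sym (inverseˡ ∣ σ ∣)) (trans (cong (∣ σ ∣ ⟨$⟩ˡ_) eq) (inverseˡ ∣ σ ∣))

-- Right multiplication acts on positions: it precomposes `∣ σ ∣` with the transposition, the
-- situation of `inv-transpose`.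
sign-·-s : (σ : B (suc m)) (k : Fin m) → sign (σ · s (suc k)) ≡ sign σ ℙ.⁻¹
sign-·-s {m} σ k = begin
  sign (σ · s (suc k))                                       ≡⟨ sign-inv (σ · s (suc k)) ⟩
  parity (inv (f ∘ (transpose (inject₁ k) (suc k) ⟨$⟩ʳ_)))   ≡⟨ flip (inv-transpose f (∣∣-injective σ) k) ⟩
  parity (inv f) ℙ.⁻¹                                        ≡⟨ cong ℙ._⁻¹ (sign-inv σ) ⟨
  sign σ ℙ.⁻¹                                                ∎
  where
  open ≡-Reasoning
  f : Fin (suc m) → Fin (suc m)
  f = ∣ σ ∣ ⟨$⟩ʳ_

  flip : ∀ {i j} → i ≡ suc j ⊎ j ≡ suc i → parity i ≡ parity j ℙ.⁻¹
  flip {j = j} (inj₁ refl) = sym (Parity.⁻¹-selfInverse (Parity.suc-homo-⁻¹ j))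
  flip {i = i} (inj₂ refl) = sym (Parity.suc-homo-⁻¹ i)

-- The subgroups fixing all large indices

from-cong : {σ τ : B m} → σ ≈ τ → ∀ x → from σ x ≡ from τ x
from-cong {m} {σ} {τ} = Group.⁻¹-cong (B-group m) {σ} {τ}

to-injective : (σ : B m) → ∀ {x y} → to σ x ≡ to σ y → x ≡ y
to-injective σ {x} {y} eq = trans (sym (from-to σ x)) (trans (cong (from σ) eq) (from-to σ y))

≈-positive : (σ τ : B m) → (∀ i → to σ (⁺ , i) ≡ to τ (⁺ , i)) → σ ≈ τ
≈-positive σ τ eq (⁺ , i) = eq i
≈-positive σ τ eq (⁻ , i) =
  trans (to-neg σ (⁺ , i)) (trans (cong neg (eq i)) (sym (to-neg τ (⁺ , i))))

-- Indices start at 0, so `Fixes ℓ σ` concerns the integers of absolute value greater than `ℓ`.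
Fixes : ℕ → Pred (B m) 0ℓ
Fixes ℓ σ = ∀ x → ℓ ≤ toℕ (proj₂ x) → to σ x ≡ x

Fixes-𝟙 : Fixes ℓ (𝟙 {m})
Fixes-𝟙 _ _ = refl

Fixes-· : (σ τ : B m) → Fixes ℓ σ → Fixes ℓ τ → Fixes ℓ (σ · τ)
Fixes-· σ τ σ-fixes τ-fixes x ℓ≤x = trans (cong (to σ) (τ-fixes x ℓ≤x)) (σ-fixes x ℓ≤x)

from-fixes : (σ : B m) → Fixes ℓ σ → ∀ x → ℓ ≤ toℕ (proj₂ x) → from σ x ≡ x
from-fixes σ σ-fixes x ℓ≤x = trans (cong (from σ) (sym (σ-fixes x ℓ≤x))) (from-to σ x)

Fixes-mono : (σ : B m) → ℓ ≤ ℓ′ → Fixes ℓ σ → Fixes ℓ′ σ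
Fixes-mono σ ℓ≤ℓ′ σ-fixes x ℓ′≤x = σ-fixes x (ℕ.≤-trans ℓ≤ℓ′ ℓ′≤x)

-- If the image of `x` had index at least `ℓ`, then `σ` would fix it, and injectivity would make it
-- equal to `x`.
to-< : (σ : B m) → Fixes ℓ σ → ∀ x → toℕ (proj₂ x) < ℓ → toℕ (proj₂ (to σ x)) < ℓ
to-< {ℓ = ℓ} σ σ-fixes x x<ℓ = ℕ.≰⇒> λ ℓ≤σx →
  ℕ.<⇒≱ x<ℓ (subst (λ y → ℓ ≤ toℕ (proj₂ y)) (to-injective σ (σ-fixes (to σ x) ℓ≤σx)) ℓ≤σx)

-- Γ ℓ is the copy of L_ℓ in B_m.  Evenness is phrased as preservation of signs under
-- right multiplication, which makes closure under products and inverses immediate.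
record Γ (ℓ : ℕ) (σ : B m) : Set where
  constructor _,_
  field
    fixes          : Fixes ℓ σ
    preserves-sign : ∀ τ → sign (τ · σ) ≡ sign τ

open Γ

Γ-mono : {σ : B m} → ℓ ≤ ℓ′ → Γ ℓ σ → Γ ℓ′ σ
Γ-mono {σ = σ} ℓ≤ℓ′ γ = Fixes-mono σ ℓ≤ℓ′ (fixes γ) , preserves-sign γ

Γ-𝟙 : Γ ℓ (𝟙 {m})
Γ-𝟙 = Fixes-𝟙 , λ τ → sign-cong (τ · 𝟙) τ (λ _ → refl)

Γ-· : {σ τ : B m} → Γ ℓ σ → Γ ℓ τ → Γ ℓ (σ · τ)
Γ-· {σ = σ} {τ} γ δ = Fixes-· σ τ (fixes γ) (fixes δ) , λ υ →
  trans (sign-cong (υ · (σ · τ)) (υ · σ · τ) (λ _ → refl))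
        (trans (preserves-sign δ (υ · σ)) (preserves-sign γ υ))

Γ-⁻¹ : {σ : B m} → Γ ℓ σ → Γ ℓ (σ ⁻¹)
Γ-⁻¹ {σ = σ} γ = from-fixes σ (fixes γ) , λ τ →
  trans (sym (preserves-sign γ (τ · σ ⁻¹)))
        (sign-cong (τ · σ ⁻¹ · σ) τ (λ x → cong (to τ) (from-to σ x)))

Γ-∏ : {σs : List (B m)} → All (Γ ℓ) σs → Γ ℓ (∏ σs)
Γ-∏ []       = Γ-𝟙
Γ-∏ (γ ∷ γs) = Γ-· γ (Γ-∏ γs)

-- The generators as elements of the subgroups `Γ`

transpose-left : (i j : Fin n) → transpose i j ⟨$⟩ʳ i ≡ j
transpose-left i j rewrite dec-true (i Fin.≟ i) refl = refl

transpose-right : (i j : Fin n) → j ≢ i → transpose i j ⟨$⟩ʳ j ≡ i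
transpose-right i j j≢i
  rewrite dec-false (j Fin.≟ i) j≢i | dec-true (j Fin.≟ j) refl = refl

transpose-other : (i j k : Fin n) → k ≢ i → k ≢ j → transpose i j ⟨$⟩ʳ k ≡ k
transpose-other i j k k≢i k≢j
  rewrite dec-false (k Fin.≟ i) k≢i | dec-false (k Fin.≟ j) k≢j = refl

a-fixes : (i : Fin n) → Fixes (2 + toℕ i) (a i)
a-fixes zero (ε , suc i) _ = refl
-- Matching three successors lets evaluation see that `s 1F`, which exchanges indices 0 and 1, fixes
-- `k`.
a-fixes {suc n} (suc i) (ε , k@(suc (suc (suc _)))) 3+i≤k =
  cong (λ l → to (s 1F) (ε , l))
    (transpose-other (inject₁ (suc i)) (suc (suc i)) k
      (≢-≤ (ℕ.≤-trans (ℕ.≤-reflexive (cong (2 +_) (Fin.toℕ-inject₁ i))) (ℕ.<⇒≤ 3+i≤k)))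
      (≢-≤ 3+i≤k))
  where
  ≢-≤ : {k l : Fin (suc (suc n))} → toℕ l < toℕ k → k ≢ l
  ≢-≤ l<k k≡l = ℕ.<⇒≢ l<k (cong toℕ (sym k≡l))
a-fixes {suc n} (suc i) (ε , 0F) ()
a-fixes {suc n} (suc i) (ε , 1F) (s≤s ())
a-fixes {suc n} (suc i) (ε , 2F) (s≤s (s≤s ()))

Γ-a : (i : Fin n) → Γ (2 + toℕ i) (a i)
Γ-a zero = a-fixes zero , sign-·-s₀
Γ-a {suc n} (suc i) = a-fixes (suc i) , λ τ → begin
  sign (τ · (s 1F · s (suc (suc i))))
    ≡⟨ sign-cong (τ · (s 1F · s (suc (suc i)))) (τ · s 1F · s (suc (suc i))) (λ _ → refl) ⟩
  sign (τ · s 1F · s (suc (suc i)))  ≡⟨ sign-·-s (τ · s 1F) (suc i) ⟩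
  sign (τ · s 1F) ℙ.⁻¹               ≡⟨ cong ℙ._⁻¹ (sign-·-s τ zero) ⟩
  (sign τ ℙ.⁻¹) ℙ.⁻¹                 ≡⟨ Parity.⁻¹-involutive (sign τ) ⟩
  sign τ                             ∎
  where open ≡-Reasoning

-- The coset representatives

⋯-≤ : (k : ℕ) (j : Fin n) → All (λ i → toℕ i ≤ toℕ j) [ k ⋯ j ]
⋯-≤ zero    zero    = z≤n ∷ []
⋯-≤ zero    (suc j) = z≤n ∷ All.map⁺ (All.map s≤s (⋯-≤ zero j))
⋯-≤ (suc k) zero    = []
⋯-≤ (suc k) (suc j) = All.map⁺ (All.map s≤s (⋯-≤ k j))

-- The identity element of R_j thereby becomes the empty product `a↓ j (suc (toℕ j))`.
⋯-empty : (j : Fin n) → [ suc (toℕ j) ⋯ j ] ≡ []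
⋯-empty zero    = refl
⋯-empty (suc j) = cong (map suc) (⋯-empty j)

Γ-a↓ : (j : Fin n) (k : ℕ) → Γ (2 + toℕ j) (a↓ j k)
Γ-a↓ j k = Γ-∏ (All.map⁺ (All.map (λ i≤j → Γ-mono (s≤s (s≤s i≤j)) (Γ-a _))
                          (All.anti-mono Any.reverse⁻ (⋯-≤ k j))))

Γ-a↑ : (k : ℕ) (j : Fin n) → Γ (2 + toℕ j) (a↑ k j)
Γ-a↑ k j = Γ-∏ (All.map⁺ (All.map (λ i≤j → Γ-mono (s≤s (s≤s i≤j)) (Γ-a _)) (⋯-≤ k j)))

-- Tracing a point through products of generators

from-∏ : (is : List (Fin n)) → ∀ x →
  from (∏ (map a is)) x ≡ foldl (λ y i → from (a i) y) x is
from-∏ []       x = refl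
from-∏ (i ∷ is) x = from-∏ is (from (a i) x)

-- Under the inverse of a product the leftmost factor acts first, which gives a left fold; reversing
-- the list turns it into a right fold.
from-∏-reverse : (is : List (Fin n)) → ∀ x →
  from (∏ (map a (reverse is))) x ≡ foldr (λ i → from (a i)) x is
from-∏-reverse is x = trans (from-∏ (reverse is) x) (reverse-foldl _ x is)

module _ {A : Set} where

  -- `p` is a path along which `f k` steps back from position `suc k` to `k`, so the fold walks from
  -- `suc j` down to `i`; the extreme `i = suc j` is the empty walk. Arbitrary `f` and `p` let the
  -- induction shift both by `suc`.
  foldr-⋯ : (f : Fin n → A → A) (p : Fin (suc n) → A) (i : Fin (suc n)) (j : Fin n) →
    toℕ i ≤ suc (toℕ j) →
    (∀ k → toℕ i ≤ toℕ k → f k (p (suc k)) ≡ p (inject₁ k)) →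
    foldr f (p (suc j)) [ toℕ i ⋯ j ] ≡ p i
  foldr-⋯ f p zero zero _ step = step zero z≤n
  foldr-⋯ f p zero (suc j) _ step =
    trans (cong (f zero) (trans (foldr-map f suc _ [ zero ⋯ j ])
            (foldr-⋯ (f ∘ suc) (p ∘ suc) zero j z≤n (λ k _ → step (suc k) z≤n))))
          (step zero z≤n)
  foldr-⋯ f p (suc zero) zero _ _ = refl
  foldr-⋯ f p (suc (suc i)) zero (s≤s ()) _
  foldr-⋯ f p (suc i) (suc j) (s≤s i≤j) step =
    trans (foldr-map f suc _ [ toℕ i ⋯ j ])
          (foldr-⋯ (f ∘ suc) (p ∘ suc) i j i≤j (λ k i≤k → step (suc k) (s≤s i≤k)))

  foldl-⋯ : (f : A → Fin n → A) (p : Fin (suc n) → A) (i : Fin (suc n)) (j : Fin n) →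
    toℕ i ≤ suc (toℕ j) →
    (∀ k → toℕ i ≤ toℕ k → f (p (inject₁ k)) k ≡ p (suc k)) →
    foldl f (p i) [ toℕ i ⋯ j ] ≡ p (suc j)
  foldl-⋯ f p zero zero _ step = step zero z≤n
  foldl-⋯ f p zero (suc j) _ step =
    trans (foldl-map f suc _ [ zero ⋯ j ])
      (trans (cong (λ x → foldl (λ y k → f y (suc k)) x [ zero ⋯ j ]) (step zero z≤n))
        (foldl-⋯ (λ y k → f y (suc k)) (p ∘ suc) zero j z≤n (λ k _ → step (suc k) z≤n)))
  foldl-⋯ f p (suc zero) zero _ _ = refl
  foldl-⋯ f p (suc (suc i)) zero (s≤s ()) _
  foldl-⋯ f p (suc i) (suc j) (s≤s i≤j) step =
    trans (foldl-map f suc _ [ toℕ i ⋯ j ])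
          (foldl-⋯ (λ y k → f y (suc k)) (p ∘ suc) i j i≤j (λ k i≤k → step (suc k) (s≤s i≤k)))

-- For k ≥ 1, a_k⁻¹ = s_{k+1} s_1 sends ε(k + 2) to ε(k + 1), since s_1 fixes k + 2 ≥ 3. The factors
-- a_j, ..., a_i thus bring ε(j + 2) down to ε(i + 1).
from-a↓ : ∀ (i : Fin (suc n)) (j : Fin n) ε → 1 ≤ toℕ i → toℕ i ≤ suc (toℕ j) →
  from (a↓ j (toℕ i)) (ε , suc j) ≡ (ε , i)
from-a↓ i j ε 1≤i i≤1+j =
  trans (from-∏-reverse [ toℕ i ⋯ j ] _)
        (foldr-⋯ _ (ε ,_) i j i≤1+j (λ k i≤k → step k (ℕ.≤-trans 1≤i i≤k)))
  where
  step : (k : Fin n) → 1 ≤ toℕ k → from (a k) (ε , suc k) ≡ (ε , inject₁ k)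
  step {suc _} (suc k) _ = cong (ε ,_) (transpose-left (suc (suc k)) (inject₁ (suc k)))

-- Under a₁⁻¹, a₂⁻¹, … the point -1 runs through -3, -4, …, so that in this
-- indexing it takes the place of -2.
negate-swap : Fin (suc (suc n)) → ± (suc (suc n))
negate-swap 0F            = ⁻ , 1F
negate-swap 1F            = ⁻ , 0F
negate-swap (suc (suc i)) = ⁻ , suc (suc i)

from-a↑ : (k : Fin (suc n)) → from (a↑ 1 k) (⁻ , 0F) ≡ negate-swap (suc k)
from-a↑ k = trans (from-∏ [ 1 ⋯ k ] _) (foldl-⋯ _ negate-swap 1F k (s≤s z≤n) step)
  where
  step : (k : Fin (suc n)) → 1 ≤ toℕ k →
    from (a k) (negate-swap (inject₁ k)) ≡ negate-swap (suc k)
  step {suc _} 1F _ = refl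
  step {suc (suc _)} (suc (suc k)) _ =
    cong (⁻ ,_) (transpose-right (suc (suc (suc k))) (inject₁ (suc (suc k)))
      (λ eq → ℕ.<⇒≢ (ℕ.n<1+n (2 + toℕ k))
        (trans (sym (Fin.toℕ-inject₁ (suc (suc k)))) (cong toℕ eq))))

-- rep j x is the element r of R_j with r⁻¹(j + 2) = x.
rep : Fin (suc (suc n)) → ± (suc (suc (suc n))) → B (suc (suc (suc n)))
rep j (⁺ , 0F)          = a↓ j 2 · a₁ ⁻¹
rep j (⁺ , suc i)       = a↓ j (suc (toℕ i))
rep j (⁻ , 0F)          = a↓ j 2 · a₁ ⁻¹ · a₀
rep j (⁻ , 1F)          = a↓ j 2 · a₁ ⁻¹ · a₀ · a₁ ⁻¹
rep j (⁻ , suc (suc i)) = a↓ j 2 · a₁ ⁻¹ · a₀ · a↑ 1 (suc i)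

module _ (j : Fin (suc n)) where

  private
    from-a↓2 : from (a↓ (suc j) 2) (⁺ , suc (suc j)) ≡ (⁺ , 2F)
    from-a↓2 = from-a↓ 2F (suc j) ⁺ (s≤s z≤n) (s≤s (s≤s z≤n))

    Γ-a₁⁻¹ : Γ (3 + toℕ j) (a₁ {n} ⁻¹)
    Γ-a₁⁻¹ = Γ-⁻¹ (Γ-mono (s≤s (s≤s (s≤s z≤n))) (Γ-a 1F))

    Γ-stem : Γ (3 + toℕ j) (a↓ (suc j) 2 · a₁ ⁻¹)
    Γ-stem = Γ-· (Γ-a↓ (suc j) 2) Γ-a₁⁻¹

    Γ-stem-a₀ : Γ (3 + toℕ j) (a↓ (suc j) 2 · a₁ ⁻¹ · a₀)
    Γ-stem-a₀ = Γ-· Γ-stem (Γ-mono (s≤s (s≤s z≤n)) (Γ-a 0F))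

  -- The point is brought to 3 by `from-a↓2`, then to 1 by `a₁`, to -1 by `a₀`, and from there to -2
  -- by `a₁` or to -3, -4, ... by `from-a↑`.
  from-rep : ∀ x → toℕ (proj₂ x) ≤ 2 + toℕ j → from (rep (suc j) x) (⁺ , suc (suc j)) ≡ x
  from-rep (⁺ , 0F) _            = cong (to a₁) from-a↓2
  from-rep (⁺ , suc i) i≤        = from-a↓ (suc i) (suc j) ⁺ (s≤s z≤n) i≤
  from-rep (⁻ , 0F) _            = cong (from a₀ ∘ to a₁) from-a↓2
  from-rep (⁻ , 1F) _            = cong (to a₁ ∘ from a₀ ∘ to a₁) from-a↓2
  from-rep (⁻ , suc (suc i)) _   =
    trans (cong (from (a↑ 1 (suc i)) ∘ from a₀ ∘ to a₁) from-a↓2) (from-a↑ (suc i))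

  Γ-rep : ∀ x → toℕ (proj₂ x) ≤ 2 + toℕ j → Γ (3 + toℕ j) (rep (suc j) x)
  Γ-rep (⁺ , 0F) _          = Γ-stem
  Γ-rep (⁺ , suc i) _       = Γ-a↓ (suc j) (suc (toℕ i))
  Γ-rep (⁻ , 0F) _          = Γ-stem-a₀
  Γ-rep (⁻ , 1F) _          = Γ-· Γ-stem-a₀ Γ-a₁⁻¹
  Γ-rep (⁻ , suc (suc i)) i≤ = Γ-· Γ-stem-a₀ (Γ-mono (s≤s i≤) (Γ-a↑ 1 (suc i)))

  rep-∈ : ∀ x → toℕ (proj₂ x) ≤ 2 + toℕ j → rep (suc j) x ∈ Rᴸ (suc j)
  rep-∈ (⁺ , 0F) _ = inj₁ (inj₂ (inj₂ (here λ _ → refl)))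
  -- At equality the lower end `suc (toℕ i)` exceeds the top index, so the product is empty; `Rᴬ`
  -- lists that element separately as `𝟙`.
  rep-∈ (⁺ , suc i) (s≤s i≤) with toℕ i ℕ.≟ suc (toℕ j)
  ... | yes i≡ = inj₁ (inj₁ (here λ x → cong (λ is → to (∏ (map a (reverse is))) x)
                  (trans (cong (λ k → [ suc k ⋯ suc j ]) i≡) (⋯-empty (suc j)))))
  ... | no i≢  = inj₁ (inj₂ (inj₁ (suc (toℕ i) , s≤s z≤n , ℕ.≤∧≢⇒< i≤ i≢ , λ _ → refl)))
  rep-∈ (⁻ , 0F) _ = inj₂ (inj₁ (here λ _ → refl))
  rep-∈ (⁻ , 1F) _ = inj₂ (inj₁ (there (here λ _ → refl)))
  rep-∈ (⁻ , suc (suc i)) (s≤s i≤) = inj₂ (inj₂ (suc i , s≤s z≤n , i≤ , λ _ → refl))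

  ∈-rep : ∀ r → r ∈ Rᴸ (suc j) → ∃[ x ] toℕ (proj₂ x) ≤ 2 + toℕ j × r ≈ rep (suc j) x
  ∈-rep r (inj₁ (inj₁ (here r≈))) =
    (⁺ , suc (suc j)) , ℕ.≤-refl ,
    λ x → trans (r≈ x) (cong (λ is → to (∏ (map a (reverse is))) x) (sym (⋯-empty (suc j))))
  ∈-rep r (inj₁ (inj₂ (inj₁ (suc k , _ , k<j , r≈)))) =
    (⁺ , suc i) , s≤s (ℕ.≤-trans (ℕ.≤-reflexive i≡k) (ℕ.<⇒≤ k<j)) ,
    subst (λ l → r ≈ a↓ (suc j) (suc l)) (sym i≡k) r≈
    where
    k<n : k < suc (suc n)
    k<n = ℕ.<-trans k<j (Fin.toℕ<n (suc j))
    i = fromℕ< k<n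
    i≡k = Fin.toℕ-fromℕ< k<n
  ∈-rep r (inj₁ (inj₂ (inj₂ (here r≈))))         = (⁺ , 0F) , z≤n , r≈
  ∈-rep r (inj₂ (inj₁ (here r≈)))                = (⁻ , 0F) , z≤n , r≈
  ∈-rep r (inj₂ (inj₁ (there (here r≈))))        = (⁻ , 1F) , s≤s z≤n , r≈
  ∈-rep r (inj₂ (inj₂ (suc k , _ , k≤j , r≈)))   = (⁻ , suc (suc k)) , s≤s k≤j , r≈

-- Phrased with `1 ≤ toℕ j` because the induction over factors meets indices that are not
-- syntactically successors.
representative : (j : Fin n) → 1 ≤ toℕ j → ∀ x → toℕ (proj₂ x) ≤ suc (toℕ j) →
  ∃[ r ] r ∈ Rᴸ j × Γ (2 + toℕ j) r × from r (⁺ , suc j) ≡ x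
representative {suc (suc n)} (suc j) _ x x≤ =
  rep (suc j) x , rep-∈ j x x≤ , Γ-rep j x x≤ , from-rep j x x≤

-- Each of `r` and `r′` is some `rep` of a point, and `from-rep` recovers that point from the
-- hypothesis on `from`.
Rᴸ-injective : (j : Fin n) → 1 ≤ toℕ j → ∀ r r′ → r ∈ Rᴸ j → r′ ∈ Rᴸ j →
  from r (⁺ , suc j) ≡ from r′ (⁺ , suc j) → r ≈ r′
Rᴸ-injective {suc (suc n)} (suc j) _ r r′ r∈ r′∈ eq
  with x , x≤ , r≈ ← ∈-rep j r r∈ | x′ , x′≤ , r′≈ ← ∈-rep j r′ r′∈
  = λ y → trans (r≈ y) (trans (cong (λ z → to (rep (suc j) z) y) x≡x′) (sym (r′≈ y)))
  where
  x≡x′ : x ≡ x′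
  x≡x′ = begin
    x                                          ≡⟨ from-rep j x x≤ ⟨
    from (rep (suc j) x) (⁺ , suc (suc j))     ≡⟨ from-cong {σ = r} {rep (suc j) x} r≈ _ ⟨
    from r (⁺ , suc (suc j))                   ≡⟨ eq ⟩
    from r′ (⁺ , suc (suc j))                  ≡⟨ from-cong {σ = r′} {rep (suc j) x′} r′≈ _ ⟩
    from (rep (suc j) x′) (⁺ , suc (suc j))    ≡⟨ from-rep j x′ x′≤ ⟩
    x′                                         ∎
    where open ≡-Reasoning

-- The base case: L_2 and R_0

R₀ᴸ-fixes : ∀ n r → r ∈ R₀ᴸ n → Fixes 2 r
R₀ᴸ-fixes zero    _ _ (_ , 0F) ()
R₀ᴸ-fixes zero    _ _ (_ , 1F) (s≤s ())
R₀ᴸ-fixes (suc n) _ _ (_ , 0F) ()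
R₀ᴸ-fixes (suc n) _ _ (_ , 1F) (s≤s ())
R₀ᴸ-fixes (suc n) _ (here r≈) (ε , suc (suc i)) _ = r≈ _
R₀ᴸ-fixes (suc n) _ (there (here r≈)) (ε , suc (suc i)) _ = r≈ _
-- Index 2 is treated apart because a_1⁻¹ moves 3 to 2; a_0 fixes 2, and a_1 moves it back.
R₀ᴸ-fixes (suc n) _ (there (there (here r≈))) (ε , 2F) _ = r≈ _
R₀ᴸ-fixes (suc n) _ (there (there (here r≈))) (ε , suc (suc (suc i))) _ = r≈ _
R₀ᴸ-fixes (suc n) _ (there (there (there (here r≈)))) (ε , 2F) _ = r≈ _
R₀ᴸ-fixes (suc n) _ (there (there (there (here r≈)))) (ε , suc (suc (suc i))) _ = r≈ _

Rᴸ-fixes : (j : Fin n) → ∀ r → r ∈ Rᴸ j → Fixes (2 + toℕ j) r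
Rᴸ-fixes {suc n} zero = R₀ᴸ-fixes n
Rᴸ-fixes {suc (suc n)} (suc j) r r∈ y j<y
  with x , x≤ , r≈ ← ∈-rep j r r∈ = trans (r≈ y) (fixes (Γ-rep j x x≤) y j<y)

-- Otherwise σ exchanges 1 and 2 up to signs, and the sign of σ s₁ would be both 0ℙ and 1ℙ.
fixes-2⇒diagonal : (σ : B (suc (suc n))) → Fixes 2 σ → sign σ ≡ 0ℙ →
  (∃[ ε ] to σ (⁺ , 0F) ≡ (ε , 0F)) × (∃[ δ ] to σ (⁺ , 1F) ≡ (δ , 1F))
fixes-2⇒diagonal {n} σ σ-fixes even =
  cases _ _ refl refl (to-< σ σ-fixes (⁺ , 0F) (s≤s z≤n)) (to-< σ σ-fixes (⁺ , 1F) (s≤s (s≤s z≤n)))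
  where
  swapped : ∀ {ε δ} → to σ (⁺ , 0F) ≡ (ε , 1F) → to σ (⁺ , 1F) ≡ (δ , 0F) → 1ℙ ≡ 0ℙ
  swapped eq₀ eq₁ = begin
    0ℙ ℙ.⁻¹                 ≡⟨ cong ℙ._⁻¹ even ⟨
    sign σ ℙ.⁻¹             ≡⟨ sign-·-s σ zero ⟨
    sign (σ · s 1F)         ≡⟨ sign-cong-abs (σ · s 1F) 𝟙
                                 (λ { 0F → cong proj₂ eq₁
                                    ; 1F → cong proj₂ eq₀
                                    ; (suc (suc i)) → cong proj₂ (σ-fixes _ (s≤s (s≤s z≤n))) }) ⟩
    sign (𝟙 {suc (suc n)})  ≡⟨ sign-𝟙 {suc (suc n)} ⟩
    0ℙ                      ∎
    where open ≡-Reasoning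

  cases : ∀ x y → to σ (⁺ , 0F) ≡ x → to σ (⁺ , 1F) ≡ y →
    toℕ (proj₂ x) < 2 → toℕ (proj₂ y) < 2 →
    (∃[ ε ] to σ (⁺ , 0F) ≡ (ε , 0F)) × (∃[ δ ] to σ (⁺ , 1F) ≡ (δ , 1F))
  cases (ε , 0F) (δ , 1F) eq₀ eq₁ _ _ = (ε , eq₀) , (δ , eq₁)
  cases (ε , 1F) (δ , 0F) eq₀ eq₁ _ _ with () ← swapped eq₀ eq₁
  cases (ε , 0F) (δ , 0F) eq₀ eq₁ _ _
    with () ← ∣∣-injective σ (trans (cong proj₂ eq₀) (sym (cong proj₂ eq₁)))
  cases (ε , 1F) (δ , 1F) eq₀ eq₁ _ _
    with () ← ∣∣-injective σ (trans (cong proj₂ eq₀) (sym (cong proj₂ eq₁)))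
  cases (_ , suc (suc _)) _ _ _ (s≤s (s≤s ())) _
  cases _ (_ , suc (suc _)) _ _ _ (s≤s (s≤s ()))

-- Two signs determine `σ`. For `zero` the listed windows are the four choices; for `suc n` they are
-- realised by a_0, which negates 1, and a_1 a_0 a_1⁻¹, which negates 2.
fixes-2⇒R₀ᴸ : ∀ n (σ : B (suc (suc n))) → Fixes 2 σ → sign σ ≡ 0ℙ → σ ∈ R₀ᴸ n
fixes-2⇒R₀ᴸ zero σ σ-fixes even with fixes-2⇒diagonal σ σ-fixes even
... | (ε , eq₀) , (δ , eq₁) = cases ε δ (cong₂ (λ x y → x Vec.∷ y Vec.∷ Vec.[]) eq₀ eq₁)
  where
  cases : ∀ ε δ → window σ ≡ (ε , 0F) Vec.∷ (δ , 1F) Vec.∷ Vec.[] → σ ∈ R₀ᴸ zero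
  cases ⁺ ⁺ eq = here eq
  cases ⁻ ⁺ eq = there (here eq)
  cases ⁺ ⁻ eq = there (there (here eq))
  cases ⁻ ⁻ eq = there (there (there (here eq)))
fixes-2⇒R₀ᴸ (suc n) σ σ-fixes even with fixes-2⇒diagonal σ σ-fixes even
... | (ε , eq₀) , (δ , eq₁) = cases ε δ eq₀ eq₁
  where
  agree : ∀ {ε δ} τ → to τ (⁺ , 0F) ≡ (ε , 0F) → to τ (⁺ , 1F) ≡ (δ , 1F) → Fixes 2 τ →
    to σ (⁺ , 0F) ≡ (ε , 0F) → to σ (⁺ , 1F) ≡ (δ , 1F) → σ ≈ τ
  agree τ τ₀ τ₁ τ-fixes σ₀ σ₁ = ≈-positive σ τ λ
    { 0F → trans σ₀ (sym τ₀)
    ; 1F → trans σ₁ (sym τ₁)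
    ; (suc (suc i)) → trans (σ-fixes _ (s≤s (s≤s z≤n))) (sym (τ-fixes _ (s≤s (s≤s z≤n)))) }

  cases : ∀ ε δ → to σ (⁺ , 0F) ≡ (ε , 0F) → to σ (⁺ , 1F) ≡ (δ , 1F) → σ ∈ R₀ᴸ (suc n)
  cases ⁺ ⁺ σ₀ σ₁ = here (agree 𝟙 refl refl Fixes-𝟙 σ₀ σ₁)
  cases ⁻ ⁺ σ₀ σ₁ = there (here (agree a₀ refl refl
    (R₀ᴸ-fixes (suc n) a₀ (there (here λ _ → refl))) σ₀ σ₁))
  cases ⁺ ⁻ σ₀ σ₁ = there (there (here (agree (a₁ · a₀ · a₁ ⁻¹) refl refl
    (R₀ᴸ-fixes (suc n) (a₁ · a₀ · a₁ ⁻¹) (there (there (here λ _ → refl)))) σ₀ σ₁)))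
  cases ⁻ ⁻ σ₀ σ₁ = there (there (there (here (agree (a₀ · a₁ · a₀ · a₁ ⁻¹) refl refl
    (R₀ᴸ-fixes (suc n) (a₀ · a₁ · a₀ · a₁ ⁻¹) (there (there (there (here λ _ → refl))))) σ₀ σ₁))))

fixes-2⇒Rᴸ : (j : Fin n) → toℕ j ≡ 0 → (σ : B (suc n)) → Fixes 2 σ → sign σ ≡ 0ℙ → σ ∈ Rᴸ j
fixes-2⇒Rᴸ {suc n} zero _ = fixes-2⇒R₀ᴸ n

-- Splitting off the last factor

∏ᵥ-∷ʳ : ∀ k (ρ : Fin (suc k) → B m) → ∏ᵥ ρ ≈ ∏ᵥ (ρ ∘ inject₁) · ρ (fromℕ k)
∏ᵥ-∷ʳ zero    ρ x = refl
∏ᵥ-∷ʳ (suc k) ρ x = cong (to (ρ zero)) (∏ᵥ-∷ʳ k (ρ ∘ suc) x)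

∏ᵥ-cong : ∀ k (ρ ρ′ : Fin k → B m) → (∀ i → ρ i ≈ ρ′ i) → ∏ᵥ ρ ≈ ∏ᵥ ρ′
∏ᵥ-cong zero    ρ ρ′ eq x = refl
∏ᵥ-cong (suc k) ρ ρ′ eq x =
  trans (cong (to (ρ zero)) (∏ᵥ-cong k (ρ ∘ suc) (ρ′ ∘ suc) (eq ∘ suc) x)) (eq zero _)

∏ᵥ-fixes : ∀ k (ρ : Fin k → B m) → (∀ i → Fixes ℓ (ρ i)) → Fixes ℓ (∏ᵥ ρ)
∏ᵥ-fixes zero    ρ ρ-fixes = Fixes-𝟙
∏ᵥ-fixes (suc k) ρ ρ-fixes =
  Fixes-· (ρ zero) (∏ᵥ (ρ ∘ suc)) (ρ-fixes zero) (∏ᵥ-fixes k (ρ ∘ suc) (ρ-fixes ∘ suc))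

-- Taking the view as an argument allows `view-inject₁` and `view-fromℕ` to be applied under `cong`.
∷ʳ-View : {A : Set} {k : ℕ} → (Fin k → A) → A → {i : Fin (suc k)} → View i → A
∷ʳ-View ρ r ‵fromℕ       = r
∷ʳ-View ρ r (‵inject₁ i) = ρ i

_∷ʳ_ : {A : Set} {k : ℕ} → (Fin k → A) → A → Fin (suc k) → A
(ρ ∷ʳ r) i = ∷ʳ-View ρ r (view i)

∷ʳ-inject₁ : {A : Set} {k : ℕ} (ρ : Fin k → A) (r : A) (i : Fin k) → (ρ ∷ʳ r) (inject₁ i) ≡ ρ i
∷ʳ-inject₁ ρ r i = cong (∷ʳ-View ρ r) (view-inject₁ i)

∷ʳ-fromℕ : {A : Set} (k : ℕ) (ρ : Fin k → A) (r : A) → (ρ ∷ʳ r) (fromℕ k) ≡ r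
∷ʳ-fromℕ k ρ r = cong (∷ʳ-View ρ r) (view-fromℕ k)

∀-view : {k : ℕ} (P : Pred (Fin (suc k)) 0ℓ) → (∀ i → P (inject₁ i)) → P (fromℕ k) → ∀ i → P i
∀-view P init last i with view i
... | ‵fromℕ     = last
... | ‵inject₁ j = init j

-- The induction is on the number k of factors while the ambient group stays B (suc n);
-- e embeds the indices 0, …, k - 1 of the factors into Fin n.
module _ {n : ℕ} where

  Inclusion : {k : ℕ} → (Fin k → Fin n) → Set
  Inclusion e = ∀ i → toℕ (e i) ≡ toℕ i

  inclusion-init : ∀ {k} {e : Fin (suc k) → Fin n} → Inclusion e → Inclusion (e ∘ inject₁)
  inclusion-init incl i = trans (incl (inject₁ i)) (Fin.toℕ-inject₁ i)

  inclusion-last : ∀ {k} {e : Fin (suc k) → Fin n} → Inclusion e → toℕ (e (fromℕ k)) ≡ k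
  inclusion-last {k} incl = trans (incl (fromℕ k)) (Fin.toℕ-fromℕ k)

  factorize : ∀ k (e : Fin (suc k) → Fin n) → Inclusion e →
    (σ : B (suc n)) → Fixes (2 + k) σ → sign σ ≡ 0ℙ →
    ∃[ ρ ] (∀ i → ρ i ∈ Rᴸ (e i)) × σ ≈ ∏ᵥ ρ
  factorize zero e incl σ σ-fixes even =
    (λ _ → σ) , (λ { zero → fixes-2⇒Rᴸ (e zero) (incl zero) σ σ-fixes even }) , (λ _ → refl)
  factorize (suc k) e incl σ σ-fixes even =
    -- `r` is chosen with `from r last ≡ from σ last`, so that `σ · r ⁻¹` fixes `last`.
    let r , r∈ , γ , r-last = representative j 1≤j (from σ last) from-last-≤
        σ′ = σ · r ⁻¹
        γ⁻¹ = Γ-⁻¹ (subst (λ l → Γ (2 + l) r) j≡ γ)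
        σ′-last : to σ′ last ≡ last
        σ′-last = trans (cong (to σ) r-last) (to-from σ last)
        ρ , ρ∈ , σ′≈ = factorize k (e ∘ inject₁) (inclusion-init incl) σ′
          (fixes-pred σ′ (Fixes-· σ (r ⁻¹) σ-fixes (fixes γ⁻¹)) σ′-last)
          (trans (preserves-sign γ⁻¹ σ) even)
    in  ρ ∷ʳ r
      , ∀-view (λ i → (ρ ∷ʳ r) i ∈ Rᴸ (e i))
          (λ i → subst (_∈ Rᴸ (e (inject₁ i))) (sym (∷ʳ-inject₁ ρ r i)) (ρ∈ i))
          (subst (_∈ Rᴸ j) (sym (∷ʳ-fromℕ (suc k) ρ r)) r∈)
      , λ x → begin
          to σ x
            ≡⟨ cong (to σ) (from-to r x) ⟨
          to σ′ (to r x)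
            ≡⟨ σ′≈ (to r x) ⟩
          to (∏ᵥ ρ) (to r x)
            ≡⟨ ∏ᵥ-cong (suc k) ((ρ ∷ʳ r) ∘ inject₁) ρ (λ i y → cong (λ τ → to τ y) (∷ʳ-inject₁ ρ r i)) (to r x) ⟨
          to (∏ᵥ ((ρ ∷ʳ r) ∘ inject₁)) (to r x)
            ≡⟨ cong (λ τ → to (∏ᵥ ((ρ ∷ʳ r) ∘ inject₁)) (to τ x)) (∷ʳ-fromℕ (suc k) ρ r) ⟨
          to (∏ᵥ ((ρ ∷ʳ r) ∘ inject₁) · (ρ ∷ʳ r) (fromℕ (suc k))) x
            ≡⟨ ∏ᵥ-∷ʳ (suc k) (ρ ∷ʳ r) x ⟨
          to (∏ᵥ (ρ ∷ʳ r)) x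
            ∎
    where
    open ≡-Reasoning
    j = e (fromℕ (suc k))
    last = ⁺ , suc j

    j≡ : toℕ j ≡ suc k
    j≡ = inclusion-last incl

    1≤j : 1 ≤ toℕ j
    1≤j = subst (1 ≤_) (sym j≡) (s≤s z≤n)

    from-last-≤ : toℕ (proj₂ (from σ last)) ≤ suc (toℕ j)
    from-last-≤ = ℕ.≤-pred (to-< (σ ⁻¹) (from-fixes σ (subst (λ l → Fixes (2 + l) σ) (sym j≡) σ-fixes))
      last (ℕ.n<1+n _))

    -- The one index between the two bounds is `2 + k`, that of `last`; its negative point follows
    -- by `to-neg`.
    fixes-pred : (τ : B (suc n)) → Fixes (3 + k) τ → to τ last ≡ last → Fixes (2 + k) τ
    fixes-pred τ τ-fixes τ-last (ε , i) 2+k≤i with 2 + k ℕ.≟ toℕ i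
    ... | no ≢i = τ-fixes (ε , i) (ℕ.≤∧≢⇒< 2+k≤i ≢i)
    ... | yes ≡i = subst (λ l → to τ (ε , l) ≡ (ε , l))
      (Fin.toℕ-injective (trans (cong suc j≡) ≡i)) (to-last ε)
      where
      to-last : ∀ ε → to τ (ε , suc j) ≡ (ε , suc j)
      to-last ⁺ = τ-last
      to-last ⁻ = trans (to-neg τ last) (cong neg τ-last)

  -- The inverse of the product, evaluated at `last`, determines the last factor by `Rᴸ-injective`;
  -- cancelling that factor leaves the shorter products to the induction.
  factors-unique : ∀ k (e : Fin (suc k) → Fin n) → Inclusion e →
    (ρ ρ′ : Fin (suc k) → B (suc n)) → (∀ i → ρ i ∈ Rᴸ (e i)) → (∀ i → ρ′ i ∈ Rᴸ (e i)) →
    ∏ᵥ ρ ≈ ∏ᵥ ρ′ → ∀ i → ρ i ≈ ρ′ i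
  factors-unique zero e incl ρ ρ′ ρ∈ ρ′∈ eq zero = eq
  factors-unique (suc k) e incl ρ ρ′ ρ∈ ρ′∈ eq = ∀-view (λ i → ρ i ≈ ρ′ i)
    (factors-unique k (e ∘ inject₁) (inclusion-init incl) _ _ (ρ∈ ∘ inject₁) (ρ′∈ ∘ inject₁) init≈)
    last≈
    where
    open ≡-Reasoning
    j = e (fromℕ (suc k))
    last = ⁺ , suc j
    r  = ρ (fromℕ (suc k))
    r′ = ρ′ (fromℕ (suc k))

    1≤j : 1 ≤ toℕ j
    1≤j = subst (1 ≤_) (sym (inclusion-last incl)) (s≤s z≤n)

    -- Under the inverse the earlier factors act first, and they fix `last` because their sets have
    -- smaller index.
    from-∏-last : (τ : Fin (suc (suc k)) → B (suc n)) → (∀ i → τ i ∈ Rᴸ (e i)) →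
      from (∏ᵥ τ) last ≡ from (τ (fromℕ (suc k))) last
    from-∏-last τ τ∈ = begin
      from (∏ᵥ τ) last
        ≡⟨ from-cong {σ = ∏ᵥ τ} {init · τ (fromℕ (suc k))} (∏ᵥ-∷ʳ (suc k) τ) last ⟩
      from (τ (fromℕ (suc k))) (from init last)
        ≡⟨ cong (from (τ (fromℕ (suc k)))) (from-fixes init init-fixes last
             (ℕ.≤-reflexive (cong suc (sym (inclusion-last incl))))) ⟩
      from (τ (fromℕ (suc k))) last
        ∎
      where
      init = ∏ᵥ (τ ∘ inject₁)
      init-fixes : Fixes (2 + k) init
      init-fixes = ∏ᵥ-fixes (suc k) (τ ∘ inject₁) λ i →
        Fixes-mono (τ (inject₁ i))
          (s≤s (s≤s (ℕ.≤-trans (ℕ.≤-reflexive (inclusion-init incl i)) (ℕ.≤-pred (Fin.toℕ<n i)))))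
          (Rᴸ-fixes (e (inject₁ i)) (τ (inject₁ i)) (τ∈ (inject₁ i)))

    last≈ : r ≈ r′
    last≈ = Rᴸ-injective j 1≤j r r′ (ρ∈ _) (ρ′∈ _) (begin
      from r last         ≡⟨ from-∏-last ρ ρ∈ ⟨
      from (∏ᵥ ρ) last    ≡⟨ from-cong {σ = ∏ᵥ ρ} {∏ᵥ ρ′} eq last ⟩
      from (∏ᵥ ρ′) last   ≡⟨ from-∏-last ρ′ ρ′∈ ⟩
      from r′ last        ∎)

    init≈ : ∏ᵥ (ρ ∘ inject₁) ≈ ∏ᵥ (ρ′ ∘ inject₁)
    init≈ x = begin
      to (∏ᵥ (ρ ∘ inject₁)) x                     ≡⟨ cong (to (∏ᵥ (ρ ∘ inject₁))) (to-from r x) ⟨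
      to (∏ᵥ (ρ ∘ inject₁) · r) (from r x)        ≡⟨ ∏ᵥ-∷ʳ (suc k) ρ (from r x) ⟨
      to (∏ᵥ ρ) (from r x)                        ≡⟨ eq (from r x) ⟩
      to (∏ᵥ ρ′) (from r x)                       ≡⟨ ∏ᵥ-∷ʳ (suc k) ρ′ (from r x) ⟩
      -- Equality of the last factors turns `r′` into `r`, which then cancels against `from r`.
      to (∏ᵥ (ρ′ ∘ inject₁)) (to r′ (from r x))   ≡⟨ cong (to (∏ᵥ (ρ′ ∘ inject₁))) (last≈ (from r x)) ⟨
      to (∏ᵥ (ρ′ ∘ inject₁)) (to r (from r x))    ≡⟨ cong (to (∏ᵥ (ρ′ ∘ inject₁))) (to-from r x) ⟩
      to (∏ᵥ (ρ′ ∘ inject₁)) x                    ∎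

theorem2p11 : (n : ℕ) → 1 ≤ n → (π : B (suc n)) → π ∈ L (suc n) →
    ∃! {A = Fin n → B (suc n)} (λ ρ ρ′ → ∀ j → ρ j ≈ ρ′ j)
    (λ ρ → (∀ j → ρ j ∈ Rᴸ j) × π ≈ ∏ᵥ ρ)
theorem2p11 (suc k) _ π π∈L =
  let ρ , ρ∈ , π≈ = factorize k id (λ _ → refl) π
        -- In `B (2 + k)` no index reaches `2 + k`, so `Fixes (2 + k) π` holds vacuously.
        (λ x 2+k≤x → contradiction (Fin.toℕ<n (proj₂ x)) (ℕ.≤⇒≯ 2+k≤x)) (sign-L {σ = π} π∈L)
  in  ρ , (ρ∈ , π≈) , λ {ρ′} (ρ′∈ , π≈′) →
        factors-unique k id (λ _ → refl) ρ ρ′ ρ∈ ρ′∈ (λ x → trans (sym (π≈ x)) (π≈′ x))
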